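{- For all $P,Q\in C_A$, $P=_{rpse}Q$ if and only if $P=_{rpbf}Q$; that is, $rpse(P)=rpse(Q)$ if and only if $rpbf(P)=rpbf(Q)$.
   Context: Let $A$ be a countable set (of atoms) with at least two elements. $C_A$ is the set of closed terms (conditional statements) over the signature with constants $T$, $F$, a constant $a$ for each $a\in A$, and one ternary operation $x\triangleleft y\triangleright z$ (the conditional, "if $y$ then $x$ else $z$"). Evaluation trees: the set $\mathcal T_A$ is defined inductively by $T\in\mathcal T_A$, $F\in\mathcal T_A$, and $(X\trianglelefteq a\trianglerighteq Y)\in\mathcal T_A$ for all $X,Y\in\mathcal T_A$, $a\in A$ (binary tree with root $a$, left branch $X$, right branch $Y$). Leaf replacement: for $Y,Z\in\mathcal T_A$, $X[T\mapsto Y,F\mapsto Z]$ is defined by $T[T\mapsto Y,F\mapsto Z]=Y$, $F[T\mapsto Y,F\mapsto Z]=Z$, $(X_1\trianglelefteq a\trianglerighteq X_2)[T\mapsto Y,F\mapsto Z]=X_1[T\mapsto Y,F\mapsto Z]\trianglelefteq a\trianglerighteq X_2[T\mapsto Y,F\mapsto Z]$. The short-circuit evaluation function $se:C_A\to\mathcal T_A$ is defined by $se(T)=T$, $se(F)=F$, $se(a)=T\trianglelefteq a\trianglerighteq F$ for $a\in A$, and $se(P\triangleleft Q\triangleright R)=se(Q)[T\mapsto se(P),F\mapsto se(R)]$. Repetition-proof evaluation trees: for $a\in A$ define $F_a,G_a:\mathcal T_A\to\mathcal T_A$ by $F_a(B)=G_a(B)=B$ for $B\in\{T,F\}$; $F_a(X\trianglelefteq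 a\trianglerighteq Y)=F_a(X)\trianglelefteq a\trianglerighteq F_a(X)$; $G_a(X\trianglelefteq a\trianglerighteq Y)=G_a(Y)\trianglelefteq a\trianglerighteq G_a(Y)$; and $F_a(X\trianglelefteq b\trianglerighteq Y)=G_a(X\trianglelefteq b\trianglerighteq Y)=X\trianglelefteq b\trianglerighteq Y$ if $b\neq a$. Define $rp:\mathcal T_A\to\mathcal T_A$ (by recursion on depth) by $rp(T)=T$, $rp(F)=F$, $rp(X\trianglelefteq a\trianglerighteq Y)=rp(F_a(X))\trianglelefteq a\trianglerighteq rp(G_a(Y))$. Then $rpse:C_A\to\mathcal T_A$ is $rpse(P)=rp(se(P))$, and $P=_{rpse}Q$ iff $rpse(P)=rpse(Q)$. Basic forms: $BF_A\subseteq C_A$ is given by the grammar $t::=T\mid F\mid t\triangleleft a\triangleright t$ ($a\in A$). For $P,Q,R\in BF_A$, $P[T\mapsto Q,F\mapsto R]\in BF_A$ is obtained by replacing all occurrences of $T$ in $P$ by $Q$ and all occurrences of $F$ in $P$ by $R$ (simultaneously). The basic form function $bf:C_A\to BF_A$ is defined by $bf(T)=T$, $bf(F)=F$, $bf(a)=T\triangleleft a\triangleright F$ for $a\in A$, $bf(P\triangleleft Q\triangleright R)=bf(Q)[T\mapsto bf(P),F\mapsto bf(R)]$. The function $rpbf$: for $a\in A$ define $f_a,g_a:BF_A\to BF_A$ by $f_a(B)=g_a(B)=B$ for $B\in\{T,F\}$; $f_a(P\triangleleft a\triangleright Q)=f_a(P)\triangleleft a\triangleright f_a(P)$; $g_a(P\triangleleft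 a\triangleright Q)=g_a(Q)\triangleleft a\triangleright g_a(Q)$; and $f_a(P\triangleleft b\triangleright Q)=g_a(P\triangleleft b\triangleright Q)=P\triangleleft b\triangleright Q$ if $b\neq a$. Define $rpf:BF_A\to BF_A$ (by recursion on depth) by $rpf(T)=T$, $rpf(F)=F$, $rpf(P\triangleleft a\triangleright Q)=rpf(f_a(P))\triangleleft a\triangleright rpf(g_a(Q))$. Then $rpbf(P)=rpf(bf(P))$ for $P\in C_A$, and $P=_{rpbf}Q$ iff $rpbf(P)=rpbf(Q)$ (syntactic equality). -}

module Defs where

open import Data.Bool.Base using (if_then_else_)
open import Data.Nat.Base using (ℕ; zero; suc; _≤_; _<_; _⊔_; s≤s; z≤n)
open import Data.Nat.Induction using (Acc; acc; <-wellFounded)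
open import Data.Nat.Properties using (≤-refl; ≤-trans; ⊔-lub; m≤m⊔n; m≤n⊔m)
open import Data.Product.Base using (∃; _,_; proj₁)
open import Relation.Binary.Definitions using (DecidableEquality)
open import Relation.Binary.PropositionalEquality using (_≡_; refl; cong₂)
open import Relation.Nullary.Decidable using (does; yes; no)

-- P ◁ Q ▷ R reads "if Q then P else R": the condition is the middle argument.
data C {ℓ} (A : Set ℓ) : Set ℓ where
  T F   : C A
  atom  : A → C A
  _◁_▷_ : C A → C A → C A → C A

data 𝒯 {ℓ} (A : Set ℓ) : Set ℓ where
  T F   : 𝒯 A
  _⊴_⊵_ : 𝒯 A → A → 𝒯 A → 𝒯 A

data BasicForm {ℓ} {A : Set ℓ} : C A → Set ℓ where
  T     : BasicForm T
  F     : BasicForm F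
  _◁_▷_ : ∀ {P Q} → BasicForm P → (a : A) → BasicForm Q →
          BasicForm (P ◁ atom a ▷ Q)

BF : ∀ {ℓ} → Set ℓ → Set ℓ
BF A = ∃ (BasicForm {A = A})

module _ {ℓ} {A : Set ℓ} where

  _[T↦_,F↦_] : 𝒯 A → 𝒯 A → 𝒯 A → 𝒯 A
  T             [T↦ Y ,F↦ Z ] = Y
  F             [T↦ Y ,F↦ Z ] = Z
  (X₁ ⊴ a ⊵ X₂) [T↦ Y ,F↦ Z ] = (X₁ [T↦ Y ,F↦ Z ]) ⊴ a ⊵ (X₂ [T↦ Y ,F↦ Z ])

  se : C A → 𝒯 A
  se T           = T
  se F           = F
  se (atom a)    = T ⊴ a ⊵ F
  se (P ◁ Q ▷ R) = se Q [T↦ se P ,F↦ se R ]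

  T-bf F-bf : BF A
  T-bf = T , T
  F-bf = F , F

  _◁_▷-bf_ : BF A → A → BF A → BF A
  (P , p) ◁ a ▷-bf (Q , q) = (P ◁ atom a ▷ Q) , (p ◁ a ▷ q)

  _[T↦_,F↦_]-bf : BF A → BF A → BF A → BF A
  (_ , T)         [T↦ Q ,F↦ R ]-bf = Q
  (_ , F)         [T↦ Q ,F↦ R ]-bf = R
  (_ , p ◁ a ▷ q) [T↦ Q ,F↦ R ]-bf =
    ((_ , p) [T↦ Q ,F↦ R ]-bf) ◁ a ▷-bf ((_ , q) [T↦ Q ,F↦ R ]-bf)

  bf : C A → BF A
  bf T           = T-bf
  bf F           = F-bf
  bf (atom a)    = T-bf ◁ a ▷-bf F-bf
  bf (P ◁ Q ▷ R) = bf Q [T↦ bf P ,F↦ bf R ]-bf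

  depth : 𝒯 A → ℕ
  depth T           = zero
  depth F           = zero
  depth (X ⊴ _ ⊵ Y) = suc (depth X ⊔ depth Y)

  depth-bf : BF A → ℕ
  depth-bf (_ , T)         = zero
  depth-bf (_ , F)         = zero
  depth-bf (_ , p ◁ _ ▷ q) = suc (depth-bf (_ , p) ⊔ depth-bf (_ , q))

module RepetitionProof {ℓ} {A : Set ℓ} (_≟_ : DecidableEquality A) where

  F⟨_⟩ : A → 𝒯 A → 𝒯 A
  F⟨ a ⟩ T = T
  F⟨ a ⟩ F = F
  F⟨ a ⟩ (X ⊴ b ⊵ Y) =
    if does (b ≟ a) then F⟨ a ⟩ X ⊴ a ⊵ F⟨ a ⟩ X else X ⊴ b ⊵ Y

  G⟨_⟩ : A → 𝒯 A → 𝒯 A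
  G⟨ a ⟩ T = T
  G⟨ a ⟩ F = F
  G⟨ a ⟩ (X ⊴ b ⊵ Y) =
    if does (b ≟ a) then G⟨ a ⟩ Y ⊴ a ⊵ G⟨ a ⟩ Y else X ⊴ b ⊵ Y

  F-depth : ∀ a X → depth (F⟨ a ⟩ X) ≤ depth X
  F-depth a T = z≤n
  F-depth a F = z≤n
  F-depth a (X ⊴ b ⊵ Y) with b ≟ a
  ... | yes _ = s≤s (≤-trans (⊔-lub (F-depth a X) (F-depth a X)) (m≤m⊔n _ _))
  ... | no  _ = ≤-refl

  G-depth : ∀ a X → depth (G⟨ a ⟩ X) ≤ depth X
  G-depth a T = z≤n
  G-depth a F = z≤n
  G-depth a (X ⊴ b ⊵ Y) with b ≟ a
  ... | yes _ = s≤s (≤-trans (⊔-lub (G-depth a Y) (G-depth a Y)) (m≤n⊔m (depth X) _))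
  ... | no  _ = ≤-refl

  F-smaller : ∀ X a Y → depth (F⟨ a ⟩ X) < depth (X ⊴ a ⊵ Y)
  F-smaller X a Y = s≤s (≤-trans (F-depth a X) (m≤m⊔n _ _))

  G-smaller : ∀ X a Y → depth (G⟨ a ⟩ Y) < depth (X ⊴ a ⊵ Y)
  G-smaller X a Y = s≤s (≤-trans (G-depth a Y) (m≤n⊔m (depth X) _))

  rp-acc : (X : 𝒯 A) → Acc _<_ (depth X) → 𝒯 A
  rp-acc T           _        = T
  rp-acc F           _        = F
  rp-acc (X ⊴ a ⊵ Y) (acc rs) =
    rp-acc (F⟨ a ⟩ X) (rs (F-smaller X a Y)) ⊴ a ⊵
    rp-acc (G⟨ a ⟩ Y) (rs (G-smaller X a Y))

  rp : 𝒯 A → 𝒯 A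
  rp X = rp-acc X (<-wellFounded (depth X))

  rp-acc-irrelevant : ∀ X (p q : Acc _<_ (depth X)) → rp-acc X p ≡ rp-acc X q
  rp-acc-irrelevant T           _        _        = refl
  rp-acc-irrelevant F           _        _        = refl
  rp-acc-irrelevant (X ⊴ a ⊵ Y) (acc rs) (acc ss) =
    cong₂ (_⊴ a ⊵_)
      (rp-acc-irrelevant (F⟨ a ⟩ X) (rs (F-smaller X a Y)) (ss (F-smaller X a Y)))
      (rp-acc-irrelevant (G⟨ a ⟩ Y) (rs (G-smaller X a Y)) (ss (G-smaller X a Y)))

  -- With rp T = T and rp F = F (by computation), this is the recursive
  -- definition of rp; well-founded recursion makes it propositional only.
  rp-⊴⊵ : ∀ X a Y → rp (X ⊴ a ⊵ Y) ≡ rp (F⟨ a ⟩ X) ⊴ a ⊵ rp (G⟨ a ⟩ Y)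
  rp-⊴⊵ X a Y = cong₂ (_⊴ a ⊵_)
    (rp-acc-irrelevant (F⟨ a ⟩ X) _ _)
    (rp-acc-irrelevant (G⟨ a ⟩ Y) _ _)

  rpse : C A → 𝒯 A
  rpse P = rp (se P)

  f⟨_⟩ : A → BF A → BF A
  f⟨ a ⟩ (_ , T) = T-bf
  f⟨ a ⟩ (_ , F) = F-bf
  f⟨ a ⟩ (_ , p ◁ b ▷ q) =
    if does (b ≟ a)
    then f⟨ a ⟩ (_ , p) ◁ a ▷-bf f⟨ a ⟩ (_ , p)
    else (_ , p) ◁ b ▷-bf (_ , q)

  g⟨_⟩ : A → BF A → BF A
  g⟨ a ⟩ (_ , T) = T-bf
  g⟨ a ⟩ (_ , F) = F-bf
  g⟨ a ⟩ (_ , p ◁ b ▷ q) =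
    if does (b ≟ a)
    then g⟨ a ⟩ (_ , q) ◁ a ▷-bf g⟨ a ⟩ (_ , q)
    else (_ , p) ◁ b ▷-bf (_ , q)

  f-depth : ∀ a P → depth-bf (f⟨ a ⟩ P) ≤ depth-bf P
  f-depth a (_ , T) = z≤n
  f-depth a (_ , F) = z≤n
  f-depth a (_ , p ◁ b ▷ q) with b ≟ a | f-depth a (_ , p)
  ... | yes _ | ih = s≤s (≤-trans (⊔-lub ih ih) (m≤m⊔n _ _))
  ... | no  _ | _  = ≤-refl

  g-depth : ∀ a P → depth-bf (g⟨ a ⟩ P) ≤ depth-bf P
  g-depth a (_ , T) = z≤n
  g-depth a (_ , F) = z≤n
  g-depth a (_ , p ◁ b ▷ q) with b ≟ a | g-depth a (_ , q)
  ... | yes _ | ih = s≤s (≤-trans (⊔-lub ih ih) (m≤n⊔m (depth-bf (_ , p)) _))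
  ... | no  _ | _  = ≤-refl

  f-smaller : ∀ P a Q → depth-bf (f⟨ a ⟩ P) < depth-bf (P ◁ a ▷-bf Q)
  f-smaller P a Q = s≤s (≤-trans (f-depth a P) (m≤m⊔n _ _))

  g-smaller : ∀ P a Q → depth-bf (g⟨ a ⟩ Q) < depth-bf (P ◁ a ▷-bf Q)
  g-smaller P a Q = s≤s (≤-trans (g-depth a Q) (m≤n⊔m (depth-bf P) _))

  rpf-acc : (P : BF A) → Acc _<_ (depth-bf P) → BF A
  rpf-acc (_ , T)         _        = T-bf
  rpf-acc (_ , F)         _        = F-bf
  rpf-acc (_ , p ◁ a ▷ q) (acc rs) =
    rpf-acc (f⟨ a ⟩ (_ , p)) (rs (f-smaller (_ , p) a (_ , q))) ◁ a ▷-bf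
    rpf-acc (g⟨ a ⟩ (_ , q)) (rs (g-smaller (_ , p) a (_ , q)))

  rpf : BF A → BF A
  rpf P = rpf-acc P (<-wellFounded (depth-bf P))

  rpf-acc-irrelevant : ∀ P (x y : Acc _<_ (depth-bf P)) → rpf-acc P x ≡ rpf-acc P y
  rpf-acc-irrelevant (_ , T)         _        _        = refl
  rpf-acc-irrelevant (_ , F)         _        _        = refl
  rpf-acc-irrelevant (_ , p ◁ a ▷ q) (acc rs) (acc ss) =
    cong₂ (_◁ a ▷-bf_)
      (rpf-acc-irrelevant (f⟨ a ⟩ (_ , p))
        (rs (f-smaller (_ , p) a (_ , q))) (ss (f-smaller (_ , p) a (_ , q))))
      (rpf-acc-irrelevant (g⟨ a ⟩ (_ , q))
        (rs (g-smaller (_ , p) a (_ , q))) (ss (g-smaller (_ , p) a (_ , q))))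

  rpf-◁▷ : ∀ P a Q → rpf (P ◁ a ▷-bf Q) ≡ rpf (f⟨ a ⟩ P) ◁ a ▷-bf rpf (g⟨ a ⟩ Q)
  rpf-◁▷ P a Q = cong₂ (_◁ a ▷-bf_)
    (rpf-acc-irrelevant (f⟨ a ⟩ P) _ _)
    (rpf-acc-irrelevant (g⟨ a ⟩ Q) _ _)

  rpbf : C A → BF A
  rpbf P = rpf (bf P)

  _=rpse_ : C A → C A → Set ℓ
  P =rpse Q = rpse P ≡ rpse Q

  -- Syntactic equality: basic forms are compared as terms of C A.
  _=rpbf_ : C A → C A → Set ℓ
  P =rpbf Q = proj₁ (rpbf P) ≡ proj₁ (rpbf Q)

{-# OPTIONS --safe #-}
-- On basic forms, se is an injection that reads P ◁ a ▷ Q as the tree with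
-- root a. It turns leaf substitution, f, g and rpf into leaf replacement, F, G
-- and rp, so that rpse = se ∘ rpbf.
module Submission where

open import Data.Nat.Properties using () renaming (_≟_ to _≟ℕ_)
open import Data.Nat.Base using (ℕ; _<_)
open import Data.Nat.Induction using (Acc; acc; <-wellFounded)
open import Data.Product.Base using (∃₂; _×_; _,_; proj₁; proj₂)
open import Function.Bundles using (_↣_; _⇔_; mk⇔)
open import Relation.Binary.Definitions using (DecidableEquality)
open import Relation.Binary.PropositionalEquality
  using (_≡_; _≢_; refl; sym; trans; cong; cong₂; module ≡-Reasoning)
open import Relation.Nullary.Decidable using (via-injection; yes; no)
open import Defs

-- Basic forms are evaluation trees in another notation: on them `se` sends `P ◁ atom a ▷ Q` to
-- `se P ⊴ a ⊵ se Q` by computation, so it is injective there. The definitions of `bf` and `rpf`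
-- mirror those of `se` and `rp` clause by clause, whence `se` intertwines the two sides
-- (`toTree-bf`, `toTree-rpf-acc`) and `toTree (rpbf P) ≡ rpse P`. An injective map preserves and
-- reflects equality, which gives both directions.

module _ {ℓ} {A : Set ℓ} where

  toTree : BF A → 𝒯 A
  toTree P = se (proj₁ P)

  -- Stated for variable subtrees so that `refl` matches; in `se-injective` the subtrees are stuck
  -- values of `se`.
  ⊴⊵-injective : ∀ {X X′ Y Y′ : 𝒯 A} {a a′} →
                 X ⊴ a ⊵ Y ≡ X′ ⊴ a′ ⊵ Y′ → X ≡ X′ × a ≡ a′ × Y ≡ Y′
  ⊴⊵-injective refl = refl , refl , refl

  -- The root of the tree determines the outermost constructor of a basic form. Arbitrary terms
  -- would fail: `atom a` and `T ◁ atom a ▷ F` have the same tree.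
  se-injective : ∀ {P Q : C A} → BasicForm P → BasicForm Q → se P ≡ se Q → P ≡ Q
  se-injective T           T             _  = refl
  se-injective F           F             _  = refl
  se-injective (p ◁ a ▷ q) (p′ ◁ a′ ▷ q′) eq with ⊴⊵-injective eq
  ... | eqˡ , refl , eqʳ =
    cong₂ (_◁ atom a ▷_) (se-injective p p′ eqˡ) (se-injective q q′ eqʳ)

  toTree-[T↦,F↦] : ∀ (P Q R : BF A) →
    toTree (P [T↦ Q ,F↦ R ]-bf) ≡ toTree P [T↦ toTree Q ,F↦ toTree R ]
  toTree-[T↦,F↦] (_ , T)         Q R = refl
  toTree-[T↦,F↦] (_ , F)         Q R = refl
  toTree-[T↦,F↦] (_ , p ◁ a ▷ q) Q R =
    cong₂ (_⊴ a ⊵_) (toTree-[T↦,F↦] (_ , p) Q R) (toTree-[T↦,F↦] (_ , q) Q R)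

  toTree-bf : ∀ (P : C A) → toTree (bf P) ≡ se P
  toTree-bf T           = refl
  toTree-bf F           = refl
  toTree-bf (atom a)    = refl
  toTree-bf (P ◁ Q ▷ R) = begin
    toTree (bf Q [T↦ bf P ,F↦ bf R ]-bf)
      ≡⟨ toTree-[T↦,F↦] (bf Q) (bf P) (bf R) ⟩
    toTree (bf Q) [T↦ toTree (bf P) ,F↦ toTree (bf R) ]
      ≡⟨ cong (_[T↦ _ ,F↦ _ ]) (toTree-bf Q) ⟩
    se Q [T↦ toTree (bf P) ,F↦ toTree (bf R) ]
      ≡⟨ cong₂ (se Q [T↦_,F↦_]) (toTree-bf P) (toTree-bf R) ⟩
    se Q [T↦ se P ,F↦ se R ] ∎
    where open ≡-Reasoning

module _ {ℓ} {A : Set ℓ} (_≟_ : DecidableEquality A) where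

  open RepetitionProof _≟_

  -- Both sides branch on the same test `b ≟ a`, so one case split reduces both.
  toTree-f : ∀ a P → toTree (f⟨ a ⟩ P) ≡ F⟨ a ⟩ (toTree P)
  toTree-f a (_ , T) = refl
  toTree-f a (_ , F) = refl
  toTree-f a (_ , p ◁ b ▷ q) with b ≟ a | toTree-f a (_ , p)
  ... | yes _ | ih = cong₂ (_⊴ a ⊵_) ih ih
  ... | no  _ | _  = refl

  toTree-g : ∀ a P → toTree (g⟨ a ⟩ P) ≡ G⟨ a ⟩ (toTree P)
  toTree-g a (_ , T) = refl
  toTree-g a (_ , F) = refl
  toTree-g a (_ , p ◁ b ▷ q) with b ≟ a | toTree-g a (_ , q)
  ... | yes _ | ih = cong₂ (_⊴ a ⊵_) ih ih
  ... | no  _ | _  = refl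

  -- The recursion is on the accessibility proof, since `f⟨ a ⟩` and `g⟨ a ⟩` do not return
  -- subterms.
  toTree-rpf-acc : ∀ P (x : Acc _<_ (depth-bf P)) →
                   toTree (rpf-acc P x) ≡ rp (toTree P)
  toTree-rpf-acc (_ , T)         _        = refl
  toTree-rpf-acc (_ , F)         _        = refl
  toTree-rpf-acc (_ , p ◁ a ▷ q) (acc rs) = trans
    (cong₂ (_⊴ a ⊵_)
      (trans (toTree-rpf-acc (f⟨ a ⟩ (_ , p)) (rs (f-smaller (_ , p) a (_ , q))))
             (cong rp (toTree-f a (_ , p))))
      (trans (toTree-rpf-acc (g⟨ a ⟩ (_ , q)) (rs (g-smaller (_ , p) a (_ , q))))
             (cong rp (toTree-g a (_ , q)))))
    -- The recursive equation of `rp` holds only propositionally, so it is applied explicitly.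
    (sym (rp-⊴⊵ (toTree (_ , p)) a (toTree (_ , q))))

  toTree-rpbf : ∀ P → toTree (rpbf P) ≡ rpse P
  toTree-rpbf P = trans (toTree-rpf-acc (bf P) (<-wellFounded _))
                        (cong rp (toTree-bf P))

  =rpse⇔=rpbf : ∀ P Q → (P =rpse Q) ⇔ (P =rpbf Q)
  =rpse⇔=rpbf P Q = mk⇔
    -- Injectivity applies because values of `rpbf` carry their own `BasicForm` certificates.
    (λ eq → se-injective (proj₂ (rpbf P)) (proj₂ (rpbf Q))
      (trans (toTree-rpbf P) (trans eq (sym (toTree-rpbf Q)))))
    (λ eq → trans (sym (toTree-rpbf P)) (trans (cong se eq) (toTree-rpbf Q)))

proposition3p16 : ∀ {ℓ} (A : Set ℓ) (countable : A ↣ ℕ) →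
    (∃₂ λ (a b : A) → a ≢ b) →
    let open RepetitionProof (via-injection countable _≟ℕ_) in
    (P Q : C A) → (P =rpse Q) ⇔ (P =rpbf Q)
proposition3p16 A countable _ = =rpse⇔=rpbf (via-injection countable _≟ℕ_)
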